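{- Let $k\ge 1$ be an integer, let $g$ be a graph, let $S\subseteq V(g)$ be a $k$-defective clique, and let $lb\ge 0$ be an integer (the size of the currently found best solution). Let $v_1,v_2,\dots$ be an ordering of $V(g)\setminus S$ in non-decreasing order of $|\overline{N}_S(\cdot)|$. Suppose that $v_i$ is a vertex with $i>lb-|S|$ and $$|\overline{N}_S(v_i)|>k-|\overline{E}(S)|-\sum_{j=1}^{lb-|S|}|\overline{N}_S(v_j)|.$$ Then $v_i$ can be removed from $g$; that is, every $k$-defective clique $C$ with $S\cup\{v_i\}\subseteq C\subseteq V(g)$ satisfies $|C|\le lb$.
   Context: All graphs are finite, simple and undirected. For a vertex set $A\subseteq V(g)$, $\overline{E}(A)$ is the set of non-edges (unordered pairs of distinct non-adjacent vertices) of the subgraph of $g$ induced by $A$; $A$ is a $k$-defective clique if $|\overline{E}(A)|\le k$. $\overline{N}_S(u)$ denotes the set of vertices of $S$ that are different from $u$ and not adjacent to $u$ in $g$. In a branch-and-bound search for a maximum $k$-defective clique, with $lb$ the size of the best solution found so far, only solutions of size greater than $lb$ are of interest, so a vertex $v\in V(g)\setminus S$ "can be removed from $g$" if no $k$-defective clique of size greater than $lb$ in $g$ contains $S\cup\{v\}$. A sum whose upper limit is less than $1$ is empty and equals $0$. -}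

module Defs where

open import Data.Fin.Base as Fin using (Fin)
import Data.Fin.Properties as Fin
open import Data.Fin.Subset using (Subset; ⁅_⁆; _∪_; _∈_; _∉_; _⊆_; ∣_∣)
open import Data.Fin.Subset.Properties using (_∈?_)
open import Data.List.Base using (List; allFin; cartesianProduct; filter; length; map; take)
import Data.List.Membership.Propositional as List
open import Data.List.Relation.Unary.Sorted.TotalOrder using (Sorted)
open import Data.List.Relation.Unary.Unique.Propositional using (Unique)
open import Data.Nat.Base using (ℕ; _≤_; _∸_)
open import Data.Nat.ListAction using (sum)
open import Data.Nat.Properties using (≤-totalOrder)
open import Data.Product.Base using (_×_; _,_)
open import Data.Vec.Base using (tabulate)
open import Function.Bundles using (_⇔_)
open import Level using (0ℓ)
open import Relation.Binary.Core using (Rel)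
open import Relation.Binary.Definitions using (Decidable; Irreflexive; Symmetric)
open import Relation.Binary.PropositionalEquality.Core using (_≡_; _≢_)
open import Relation.Nullary.Decidable.Core using (Dec; does; ¬?; _×-dec_)
open import Relation.Nullary.Negation.Core using (¬_)

-- Adjacency is decidable so that non-edges and non-neighbours can be counted.
record Graph (n : ℕ) : Set₁ where
  field
    Adj    : Rel (Fin n) 0ℓ
    adj?   : Decidable Adj
    sym    : Symmetric Adj
    irrefl : Irreflexive _≡_ Adj

module _ {n : ℕ} (g : Graph n) where
  open Graph g

  -- An unordered pair of distinct vertices {u , w} is represented by the one
  -- ordered pair (u , w) with u < w, so that each non-edge is counted once.
  NonEdgeIn : Subset n → Fin n × Fin n → Set
  NonEdgeIn A (u , w) = u Fin.< w × u ∈ A × w ∈ A × ¬ Adj u w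

  nonEdgeIn? : ∀ A e → Dec (NonEdgeIn A e)
  nonEdgeIn? A (u , w) =
    (u Fin.<? w) ×-dec (u ∈? A) ×-dec (w ∈? A) ×-dec ¬? (adj? u w)

  nonEdges : Subset n → List (Fin n × Fin n)
  nonEdges A = filter (nonEdgeIn? A) (cartesianProduct (allFin n) (allFin n))

  ∣E̅∣ : Subset n → ℕ
  ∣E̅∣ A = length (nonEdges A)

  IsDefectiveClique : ℕ → Subset n → Set
  IsDefectiveClique k A = ∣E̅∣ A ≤ k

  NonNeighbourIn : Subset n → Fin n → Fin n → Set
  NonNeighbourIn S u w = w ∈ S × w ≢ u × ¬ Adj u w

  nonNeighbourIn? : ∀ S u w → Dec (NonNeighbourIn S u w)
  nonNeighbourIn? S u w =
    (w ∈? S) ×-dec ¬? (w Fin.≟ u) ×-dec ¬? (adj? u w)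

  N̅ : Subset n → Fin n → Subset n
  N̅ S u = tabulate λ w → does (nonNeighbourIn? S u w)

  ∣N̅∣ : Subset n → Fin n → ℕ
  ∣N̅∣ S u = ∣ N̅ S u ∣

  record IsOrderingOutside (S : Subset n) (vs : List (Fin n)) : Set where
    field
      unique        : Unique vs
      enumerates    : ∀ u → u List.∈ vs ⇔ u ∉ S
      nonDecreasing : Sorted ≤-totalOrder (map (∣N̅∣ S) vs)

  -- The sum of ∣N̅∣ S (v_j) over 1 ≤ j ≤ lb - ∣ S ∣. Truncated subtraction makes
  -- the sum empty when the upper limit is negative.  An upper limit exceeding
  -- length vs cannot occur when some index i ≤ length vs exceeds lb - ∣ S ∣.
  prefixSum : Subset n → List (Fin n) → ℕ → ℕ
  prefixSum S vs lb = sum (map (∣N̅∣ S) (take (lb ∸ ∣ S ∣) vs))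

  CanBeRemoved : ℕ → ℕ → Subset n → Fin n → Set
  CanBeRemoved k lb S v =
    ∀ C → IsDefectiveClique k C → S ∪ ⁅ v ⁆ ⊆ C → ∣ C ∣ ≤ lb

{-# OPTIONS --safe #-}

-- Suppose ∣ C ∣ > lb, where C is a k-defective clique containing S and v = v_i.
-- Then C contains at least lb - ∣ S ∣ vertices outside S other than v, and by
-- the ordering their ∣N̅∣ S sum to at least the prefix sum.  The non-edges inside
-- S, together with those joining a vertex of C outside S to a vertex of S, are
-- distinct non-edges of C, so C has at least
-- ∣E̅∣ S + ∣N̅∣ S v + prefixSum > k non-edges.
module Submission where

open import Defs
open import Data.Fin.Base using (Fin; toℕ)
open import Data.Fin.Subset using (Subset; ∣_∣)
open import Data.Integer.Base using (+_; _-_; _>_)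
open import Data.List.Base using (List; length; lookup)
open import Data.Nat.Base using (ℕ; suc; _≤_)

import Data.Fin.Base as Fin
import Data.Fin.Properties as Fin
open import Data.Bool.Base using (true; false)
open import Data.Fin.Subset using (_∈_; _∉_; _⊆_; ⁅_⁆; inside; outside)
open import Data.Fin.Subset.Properties
  using (_∈?_; x∈⁅x⁆; p⊆p∪q; q⊆p∪q)
import Data.Integer.Base as ℤ
import Data.Integer.Properties as ℤ
open import Data.Integer.Tactic.RingSolver using (solve-∀)
open import Data.List.Base
  using ([]; _∷_; _++_; allFin; cartesianProduct; filter; map; removeAt; take; tabulate)
import Data.List.Membership.Propositional as List
open import Data.List.Membership.Propositional.Properties
  using (∈-++⁻; ∈-++⁺ˡ; ∈-++⁺ʳ; ∈-allFin; ∈-lookup; ∈-filter⁺; ∈-filter⁻;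
    ∈-cartesianProduct⁺; ∈-cartesianProduct⁻)
open import Data.List.Properties
  using (filter-++; length-++; length-map; length-removeAt′; map-cong; take-map)
open import Data.List.Relation.Binary.Sublist.Propositional as Sublist using (_∷_; _∷ʳ_)
import Data.List.Relation.Binary.Sublist.Propositional.Properties as Sublist
import Data.List.Relation.Unary.All as All
open import Data.List.Relation.Unary.AllPairs using (AllPairs; []; _∷_)
open import Data.List.Relation.Unary.Any as Any using (here; there)
open import Data.List.Relation.Unary.Sorted.TotalOrder.Properties using (Sorted⇒AllPairs)
open import Data.List.Relation.Unary.Unique.Propositional using (Unique)
import Data.List.Relation.Unary.Unique.Propositional.Properties as Unique
open import Data.Nat.Base using (zero; _+_; _∸_; _<_; z≤n; s≤s; s≤s⁻¹)
open import Data.Nat.ListAction using (sum)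
import Data.Nat.Properties as ℕ
open import Data.Product.Base using (∃; _×_; _,_; proj₁; proj₂; swap)
open import Data.Sum.Base using (_⊎_; inj₁; inj₂)
import Data.Vec.Base as Vec
open import Function.Base using (_∘_)
open import Function.Bundles using (Equivalence)
open import Level using (Level)
open import Relation.Binary.Core using (REL)
open import Relation.Binary.Definitions using (tri<; tri≈; tri>)
open import Relation.Binary.PropositionalEquality
  using (_≡_; _≢_; refl; sym; trans; cong; cong₂; subst; module ≡-Reasoning)
open import Relation.Nullary.Decidable using (does; yes; no; ¬?; _×-dec_)
open import Relation.Nullary.Negation using (¬_; contradiction)
open import Relation.Unary using (Pred; Decidable)

private
  variable
    a b p r : Level
    A : Set a
    B : Set b
    n : ℕ

-- Comparing lengths of lists by matching.

∈-removeAt : ∀ {x y : A} {xs} (x∈xs : x List.∈ xs) → y List.∈ xs → y ≢ x →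
             y List.∈ removeAt xs (Any.index x∈xs)
∈-removeAt (here refl) (here refl) y≢x = contradiction refl y≢x
∈-removeAt (here refl) (there y∈)  y≢x = y∈
∈-removeAt (there x∈)  (here refl) y≢x = here refl
∈-removeAt (there x∈)  (there y∈)  y≢x = there (∈-removeAt x∈ y∈ y≢x)

-- Pair the head with a partner `y` and delete `y` from `ys`. By injectivity no later element is
-- related to `y`, so the later partners survive the deletion and induction applies.
length-≤-matching : (R : REL A B r) {xs : List A} {ys : List B} → Unique xs →
  (∀ {x} → x List.∈ xs → ∃ λ y → y List.∈ ys × R x y) →
  (∀ {x x′ y} → x List.∈ xs → x′ List.∈ xs → R x y → R x′ y → x ≡ x′) →
  length xs ≤ length ys
length-≤-matching R []               match inj = z≤n
length-≤-matching R {ys = ys} (x∉xs ∷ xs!) match inj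
  with y , y∈ys , Rxy ← match (here refl)
  rewrite length-removeAt′ ys (Any.index y∈ys)
  = s≤s (length-≤-matching R xs!
      (λ x′∈xs → let y′ , y′∈ys , Rx′y′ = match (there x′∈xs) in
        y′ , ∈-removeAt y∈ys y′∈ys (λ { refl →
          All.lookup x∉xs x′∈xs (inj (here refl) (there x′∈xs) Rxy Rx′y′) }) , Rx′y′)
      (λ x∈ x′∈ → inj (there x∈) (there x′∈)))

length-filter-map : {P : Pred B p} (P? : Decidable P) (f : A → B) (xs : List A) →
  length (filter P? (map f xs)) ≡ length (filter (P? ∘ f) xs)
length-filter-map P? f []       = refl
length-filter-map P? f (x ∷ xs) with does (P? (f x))
... | true  = cong suc (length-filter-map P? f xs)
... | false = length-filter-map P? f xs

-- Counts pairs fibre by fibre over the first coordinate; this is how a list of crossing non-edges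
-- becomes a sum of `∣N̅∣` values.
length-filter-cartesianProduct :
  {P : Pred (A × B) p} (P? : Decidable P) (xs : List A) (ys : List B) →
  length (filter P? (cartesianProduct xs ys)) ≡
  sum (map (λ x → length (filter (λ y → P? (x , y)) ys)) xs)
length-filter-cartesianProduct P? []       ys = refl
length-filter-cartesianProduct P? (x ∷ xs) ys = begin
  length (filter P? (map (x ,_) ys ++ cartesianProduct xs ys))
    ≡⟨ cong length (filter-++ P? (map (x ,_) ys) (cartesianProduct xs ys)) ⟩
  length (filter P? (map (x ,_) ys) ++ filter P? (cartesianProduct xs ys))
    ≡⟨ length-++ (filter P? (map (x ,_) ys)) ⟩
  length (filter P? (map (x ,_) ys)) + length (filter P? (cartesianProduct xs ys))
    ≡⟨ cong₂ _+_ (length-filter-map P? (x ,_) ys) (length-filter-cartesianProduct P? xs ys) ⟩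
  sum (map (λ x′ → length (filter (λ y → P? (x′ , y)) ys)) (x ∷ xs))
    ∎
  where open ≡-Reasoning

-- Subset cardinalities as list lengths.

∣tabulate-does∣ : {P : Pred A p} (P? : Decidable P) (f : Fin n → A) →
  ∣ Vec.tabulate (does ∘ P? ∘ f) ∣ ≡ length (filter P? (tabulate f))
∣tabulate-does∣ {n = zero}  P? f = refl
∣tabulate-does∣ {n = suc n} P? f with does (P? (f Fin.zero))
... | true  = cong suc (∣tabulate-does∣ P? (f ∘ Fin.suc))
... | false = ∣tabulate-does∣ P? (f ∘ Fin.suc)

tabulate-does-∈? : (p : Subset n) → Vec.tabulate (λ x → does (x ∈? p)) ≡ p
tabulate-does-∈? Vec.[]              = refl
tabulate-does-∈? (inside  Vec.∷ p) = cong (inside Vec.∷_) (tabulate-does-∈? p)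
tabulate-does-∈? (outside Vec.∷ p) = cong (outside Vec.∷_) (tabulate-does-∈? p)

elements : Subset n → List (Fin n)
elements p = filter (_∈? p) (allFin _)

length-elements : (p : Subset n) → length (elements p) ≡ ∣ p ∣
length-elements p =
  trans (sym (∣tabulate-does∣ (_∈? p) (λ x → x))) (cong ∣_∣ (tabulate-does-∈? p))

-- `elements p` has no repetitions, so matching by equality embeds it in `elements q ++ us`;
-- overlaps and repetitions there only lengthen the right-hand list.
∣p∣≤∣q∣+length : (p q : Subset n) (us : List (Fin n)) →
  (∀ {x} → x ∈ p → x ∈ q ⊎ x List.∈ us) → ∣ p ∣ ≤ ∣ q ∣ + length us
∣p∣≤∣q∣+length p q us cover = begin
  ∣ p ∣                        ≡⟨ length-elements p ⟨
  length (elements p)          ≤⟨ length-≤-matching _≡_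
                                    (Unique.filter⁺ (_∈? p) (Unique.allFin⁺ _))
                                    (λ x∈ → _ , covered x∈ , refl)
                                    (λ _ _ x≡y x′≡y → trans x≡y (sym x′≡y)) ⟩
  length (elements q ++ us)    ≡⟨ length-++ (elements q) ⟩
  length (elements q) + length us ≡⟨ cong (_+ length us) (length-elements q) ⟩
  ∣ q ∣ + length us            ∎
  where
  open ℕ.≤-Reasoning
  covered : ∀ {x} → x List.∈ elements p → x List.∈ elements q ++ us
  covered x∈ with cover (proj₂ (∈-filter⁻ (_∈? p) {xs = allFin _} x∈))
  ... | inj₁ x∈q  = ∈-++⁺ˡ (∈-filter⁺ (_∈? q) (∈-allFin _) x∈q)
  ... | inj₂ x∈us = ∈-++⁺ʳ (elements q) x∈us

-- Inequalities for sorted sums and integers.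

-- The j-th entry of a sublist sits at position j or later in `xs`, hence is at least the j-th entry
-- of the sorted list.
sum-take-≤-sum-sublist : ∀ m {us xs} → us Sublist.⊆ xs → AllPairs _≤_ xs →
  m ≤ length us → sum (take m xs) ≤ sum us
sum-take-≤-sum-sublist zero    _                   _              _       = z≤n
-- The skipped `y` is charged to `u`, which occurs later in `xs`; the rest of the sublist still
-- embeds in `xs`.
sum-take-≤-sum-sublist (suc m) {u ∷ us} (y ∷ʳ us⊆) (y≤xs ∷ xs↗)   (s≤s m≤) =
  ℕ.+-mono-≤ (All.lookup y≤xs (Sublist.lookup us⊆ (here refl)))
             (sum-take-≤-sum-sublist m (Sublist.∷ˡ⁻ us⊆) xs↗ m≤)
sum-take-≤-sum-sublist (suc m) (refl ∷ us⊆)        (_ ∷ xs↗)      (s≤s m≤) =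
  ℕ.+-monoʳ-≤ _ (sum-take-≤-sum-sublist m us⊆ xs↗ m≤)

-- The right-hand side of the hypothesis may be negative, so the subtracted terms are moved across
-- in the integers before returning to naturals, and nothing is truncated.
m-n-o<p⇒m<n+[p+o] : ∀ m n o p → + p > + m - + n - + o → m < n + (p + o)
m-n-o<p⇒m<n+[p+o] m n o p lt = ℤ.drop‿+<+ (begin-strict
  + m                                       ≡⟨ cancel (+ m) (+ n) (+ o) ⟩
  (+ m - + n - + o) ℤ.+ (+ n ℤ.+ + o)       <⟨ ℤ.+-monoˡ-< (+ n ℤ.+ + o) lt ⟩
  + p ℤ.+ (+ n ℤ.+ + o)                     ≡⟨ exchange (+ p) (+ n) (+ o) ⟩
  + (n + (p + o)) ∎)
  where
  open ℤ.≤-Reasoning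

  cancel : ∀ x y z → x ≡ (x - y - z) ℤ.+ (y ℤ.+ z)
  cancel = solve-∀

  exchange : ∀ x y z → x ℤ.+ (y ℤ.+ z) ≡ y ℤ.+ (x ℤ.+ z)
  exchange = solve-∀

-- Counting the non-edges of a defective clique.

module _ {n : ℕ} (g : Graph n) where
  open Graph g using () renaming (sym to Adj-sym)

  ∣N̅∣≡length : ∀ S u → ∣N̅∣ g S u ≡ length (filter (nonNeighbourIn? g S u) (allFin n))
  ∣N̅∣≡length S u = ∣tabulate-does∣ (nonNeighbourIn? g S u) (λ w → w)

  ∣E̅∣+sum∣N̅∣≤∣E̅∣ : ∀ {S C us} → S ⊆ C → Unique us →
    (∀ {u} → u List.∈ us → u ∈ C × u ∉ S) →
    ∣E̅∣ g S + sum (map (∣N̅∣ g S) us) ≤ ∣E̅∣ g C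
  ∣E̅∣+sum∣N̅∣≤∣E̅∣ {S} {C} {us} S⊆C us! us⊆C∖S = begin
    ∣E̅∣ g S + sum (map (∣N̅∣ g S) us)
      ≡⟨ cong (λ ns → ∣E̅∣ g S + sum ns) (map-cong (∣N̅∣≡length S) us) ⟩
    ∣E̅∣ g S + sum (map (λ u → length (filter (nonNeighbourIn? g S u) (allFin n))) us)
      ≡⟨ cong (λ l → ∣E̅∣ g S + l) (length-filter-cartesianProduct crossing? us (allFin n)) ⟨
    ∣E̅∣ g S + length crossings
      ≡⟨ length-++ (nonEdges g S) ⟨
    length (nonEdges g S ++ crossings)
      ≤⟨ length-≤-matching SameEdge pairs! match SameEdge-injective ⟩
    ∣E̅∣ g C ∎
    where
    open ℕ.≤-Reasoning

    Crossing : Fin n × Fin n → Set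
    Crossing (u , w) = NonNeighbourIn g S u w

    crossing? : Decidable Crossing
    crossing? (u , w) = nonNeighbourIn? g S u w

    crossings : List (Fin n × Fin n)
    crossings = filter crossing? (cartesianProduct us (allFin n))

    -- A crossing puts its endpoint outside `S` first, while `nonEdges` puts the smaller endpoint
    -- first, so pairs are matched only up to `swap`.
    SameEdge : Fin n × Fin n → Fin n × Fin n → Set
    SameEdge p e = e ≡ p ⊎ e ≡ swap p

    nonEdges⁻ : ∀ {p} → p List.∈ nonEdges g S → NonEdgeIn g S p
    nonEdges⁻ p∈ = proj₂ (∈-filter⁻ (nonEdgeIn? g S) {xs = cartesianProduct (allFin n) (allFin n)} p∈)

    crossings⁻ : ∀ {u w} → (u , w) List.∈ crossings →
                 (u ∈ C × u ∉ S) × NonNeighbourIn g S u w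
    crossings⁻ p∈ =
      let p∈us× , nn = ∈-filter⁻ crossing? {xs = cartesianProduct us (allFin n)} p∈
      in us⊆C∖S (proj₁ (∈-cartesianProduct⁻ us (allFin n) p∈us×)) , nn

    nonEdges⁺ : ∀ {e} → NonEdgeIn g C e → e List.∈ nonEdges g C
    nonEdges⁺ = ∈-filter⁺ (nonEdgeIn? g C) (∈-cartesianProduct⁺ (∈-allFin _) (∈-allFin _))

    pairs! : Unique (nonEdges g S ++ crossings)
    pairs! = Unique.++⁺
      (Unique.filter⁺ (nonEdgeIn? g S) (Unique.cartesianProduct⁺ (Unique.allFin⁺ n) (Unique.allFin⁺ n)))
      (Unique.filter⁺ crossing? (Unique.cartesianProduct⁺ us! (Unique.allFin⁺ n)))
      -- The two lists are disjoint because their pairs differ in whether the first endpoint lies in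
      -- `S`.
      λ (p∈E , p∈X) → let (_ , u∈S , _) = nonEdges⁻ p∈E ; ((_ , u∉S) , _) = crossings⁻ p∈X
                      in u∉S u∈S

    match : ∀ {p} → p List.∈ nonEdges g S ++ crossings →
            ∃ λ e → e List.∈ nonEdges g C × SameEdge p e
    match p∈ with ∈-++⁻ (nonEdges g S) p∈
    ... | inj₁ p∈E = let u<w , u∈S , w∈S , ¬uw = nonEdges⁻ p∈E in
      _ , nonEdges⁺ (u<w , S⊆C u∈S , S⊆C w∈S , ¬uw) , inj₁ refl
    match {u , w} p∈ | inj₂ p∈X with crossings⁻ p∈X
    ... | (u∈C , _) , w∈S , w≢u , ¬uw with Fin.<-cmp u w
    ...   | tri< u<w _ _ = _ , nonEdges⁺ (u<w , u∈C , S⊆C w∈S , ¬uw) , inj₁ refl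
    ...   | tri≈ _ u≡w _ = contradiction (sym u≡w) w≢u
    ...   | tri> _ _ w<u = _ , nonEdges⁺ (w<u , S⊆C w∈S , u∈C , ¬uw ∘ Adj-sym) , inj₂ refl

    -- Every listed pair has its second endpoint in `S`, and a crossing has its first outside, so
    -- neither a pair nor its swap can be a crossing; two non-edges of `S` would contradict
    -- asymmetry of the order.
    swap∉ : ∀ {p} → p List.∈ nonEdges g S ++ crossings →
            ¬ swap p List.∈ nonEdges g S ++ crossings
    swap∉ p∈ q∈ with ∈-++⁻ (nonEdges g S) p∈ | ∈-++⁻ (nonEdges g S) q∈
    ... | inj₁ p∈E | inj₁ q∈E = Fin.<-asym (proj₁ (nonEdges⁻ p∈E)) (proj₁ (nonEdges⁻ q∈E))
    ... | inj₁ p∈E | inj₂ q∈X = proj₂ (proj₁ (crossings⁻ q∈X)) (proj₁ (proj₂ (proj₂ (nonEdges⁻ p∈E))))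
    ... | inj₂ p∈X | inj₁ q∈E = proj₂ (proj₁ (crossings⁻ p∈X)) (proj₁ (proj₂ (proj₂ (nonEdges⁻ q∈E))))
    ... | inj₂ p∈X | inj₂ q∈X = proj₂ (proj₁ (crossings⁻ p∈X)) (proj₁ (proj₂ (crossings⁻ q∈X)))

    SameEdge-injective : ∀ {p q e} → p List.∈ nonEdges g S ++ crossings →
      q List.∈ nonEdges g S ++ crossings → SameEdge p e → SameEdge q e → p ≡ q
    SameEdge-injective p∈ q∈ (inj₁ refl) (inj₁ refl) = refl
    SameEdge-injective p∈ q∈ (inj₁ refl) (inj₂ refl) = contradiction p∈ (swap∉ q∈)
    SameEdge-injective p∈ q∈ (inj₂ refl) (inj₁ refl) = contradiction q∈ (swap∉ p∈)
    -- Swapping twice is the identity definitionally, by eta for pairs.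
    SameEdge-injective p∈ q∈ (inj₂ refl) (inj₂ e≡)   = cong swap e≡

  -- Sortedness concerns the values, not the vertices, so `take` and the sublist relation are first
  -- transported along `∣N̅∣ g S`.
  prefixSum≤sum-filter : ∀ {S vs} {P : Pred (Fin n) p} (P? : Decidable P) → IsOrderingOutside g S vs →
    ∀ lb → lb ∸ ∣ S ∣ ≤ length (filter P? vs) →
    prefixSum g S vs lb ≤ sum (map (∣N̅∣ g S) (filter P? vs))
  prefixSum≤sum-filter {S = S} {vs} P? ord lb m≤ = begin
    sum (map f (take m vs)) ≡⟨ cong sum (take-map m vs) ⟨
    sum (take m (map f vs)) ≤⟨ sum-take-≤-sum-sublist m
                                 (Sublist.map⁺ f (Sublist.filter-⊆ P? vs))
                                 (Sorted⇒AllPairs ℕ.≤-totalOrder nonDecreasing)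
                                 (subst (m ≤_) (sym (length-map f (filter P? vs))) m≤) ⟩
    sum (map f (filter P? vs)) ∎
    where
    open ℕ.≤-Reasoning
    open IsOrderingOutside ord
    m = lb ∸ ∣ S ∣
    f = ∣N̅∣ g S

mainTheorem3 : ∀ {n} (k : ℕ) → 1 ≤ k →
    (g : Graph n) (S : Subset n) → IsDefectiveClique g k S →
    (lb : ℕ) (vs : List (Fin n)) → IsOrderingOutside g S vs →
    (i : Fin (length vs)) →
    + suc (toℕ i) > + lb - + ∣ S ∣ →
    + ∣N̅∣ g S (lookup vs i) > + k - + ∣E̅∣ g S - + prefixSum g S vs lb →
    CanBeRemoved g k lb S (lookup vs i)
mainTheorem3 {n} k _ g S _ lb vs ord i _ k-bound C C-defective S∪v⊆C = ℕ.≮⇒≥ λ lb<∣C∣ →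
  ℕ.<-irrefl refl (begin-strict
    k                                                  <⟨ m-n-o<p⇒m<n+[p+o] k (∣E̅∣ g S) (prefixSum g S vs lb) (∣N̅∣ g S v) k-bound ⟩
    ∣E̅∣ g S + (∣N̅∣ g S v + prefixSum g S vs lb)        ≤⟨ ℕ.+-monoʳ-≤ (∣E̅∣ g S) (ℕ.+-monoʳ-≤ (∣N̅∣ g S v)
                                                           (prefixSum≤sum-filter g other? ord lb (enough lb<∣C∣))) ⟩
    ∣E̅∣ g S + sum (map (∣N̅∣ g S) (v ∷ others))         ≤⟨ ∣E̅∣+sum∣N̅∣≤∣E̅∣ g S⊆C v∷others! v∷others⊆C∖S ⟩
    ∣E̅∣ g C                                            ≤⟨ C-defective ⟩
    k                                                  ∎)
  where
  open ℕ.≤-Reasoning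
  open IsOrderingOutside ord

  v : Fin n
  v = lookup vs i

  S⊆C : S ⊆ C
  S⊆C = S∪v⊆C ∘ p⊆p∪q ⁅ v ⁆

  other? : Decidable (λ u → u ∈ C × u ≢ v)
  other? u = (u ∈? C) ×-dec ¬? (u Fin.≟ v)

  -- Filtering `vs`, rather than listing `C`, makes this a sublist of the ordering. Excluding `v`
  -- lets its own contribution be added separately without counting it twice.
  others : List (Fin n)
  others = filter other? vs

  others⁻ : ∀ {u} → u List.∈ others → u List.∈ vs × u ∈ C × u ≢ v
  others⁻ = ∈-filter⁻ other? {xs = vs}

  v∷others! : Unique (v ∷ others)
  v∷others! = All.tabulate (λ u∈ v≡u → proj₂ (proj₂ (others⁻ u∈)) (sym v≡u))
            ∷ Unique.filter⁺ other? unique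

  v∷others⊆C∖S : ∀ {u} → u List.∈ v ∷ others → u ∈ C × u ∉ S
  v∷others⊆C∖S (here refl) =
    S∪v⊆C (q⊆p∪q S ⁅ v ⁆ (x∈⁅x⁆ v)) , Equivalence.to (enumerates v) (∈-lookup i)
  v∷others⊆C∖S (there u∈) =
    let u∈vs , u∈C , _ = others⁻ u∈ in u∈C , Equivalence.to (enumerates _) u∈vs

  cover : ∀ {u} → u ∈ C → u ∈ S ⊎ u List.∈ v ∷ others
  cover {u} u∈C with u ∈? S | u Fin.≟ v
  ... | yes u∈S | _       = inj₁ u∈S
  ... | no  _   | yes u≡v = inj₂ (here u≡v)
  ... | no  u∉S | no  u≢v =
    inj₂ (there (∈-filter⁺ other? (Equivalence.from (enumerates u) u∉S) (u∈C , u≢v)))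

  enough : lb < ∣ C ∣ → lb ∸ ∣ S ∣ ≤ length others
  -- The strict inequality supplies one vertex beyond `lb`, which pays for `v`; cancelling it leaves
  -- the bound for `others`. If `lb` is below `∣ S ∣`, the truncated difference is zero.
  enough lb<∣C∣ = ℕ.m≤n+o⇒m∸n≤o lb ∣ S ∣ (s≤s⁻¹ (begin
    suc lb                          ≤⟨ lb<∣C∣ ⟩
    ∣ C ∣                           ≤⟨ ∣p∣≤∣q∣+length C S (v ∷ others) cover ⟩
    ∣ S ∣ + suc (length others)     ≡⟨ ℕ.+-suc ∣ S ∣ (length others) ⟩
    suc (∣ S ∣ + length others)     ∎))
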